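{- Let $H$ be a hypergraph. The function defined on $2^{V(H)}$ which maps each $W\subseteq V(H)$ to the set $\mathscr{M}(H[W])$ of the modules of the induced subhypergraph $H[W]$ is a modular covering of $V(H)$.
   Context: All structures are finite. A hypergraph $H$ consists of a vertex set $V(H)$ and an edge set $E(H)$ which is a set of subsets of $V(H)$, each having at least $2$ elements (edges may have different sizes). For $W\subseteq V(H)$, $H[W]$ is the hypergraph with $V(H[W])=W$ and $E(H[W])=\{e\in E(H):e\subseteq W\}$. A subset $M$ of $V(H)$ is a module of $H$ if for each $e\in E(H)$ such that $e\cap M\neq\emptyset$ and $e\setminus M\neq\emptyset$, there exists $m\in M$ such that $e\cap M=\{m\}$ and for every $n\in M$, $(e\setminus\{m\})\cup\{n\}\in E(H)$. The set of modules of $H$ is denoted by $\mathscr{M}(H)$. A family $\mathscr{F}$ of subsets of a set $S$ is a partitive family on $S$ if: (i) $\emptyset\in\mathscr{F}$, $S\in\mathscr{F}$, and $\{x\}\in\mathscr{F}$ for every $x\in S$; (ii) for any $M,N\in\mathscr{F}$, $M\cap N\in\mathscr{F}$; (iii) for any $M,N\in\mathscr{F}$, if $M\cap N\neq\emptyset$, $M\setminus N\neq\emptyset$ and $N\setminus M\neq\emptyset$, then $M\cup N\in\mathscr{F}$ and $(M\setminus N)\cup(N\setminus M)\in\mathscr{F}$. A modular covering of a set $S$ is a function $\mathfrak{M}$ which associates with each $W\subseteq S$ a set $\mathfrak{M}(W)$ of subsets of $W$, and which satisfies: (A1) for each $W\subseteq S$, $\mathfrak{M}(W)$ is a partitive family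 on $W$; (A2) for any $W\subseteq W'\subseteq S$, $\{M'\cap W:M'\in\mathfrak{M}(W')\}\subseteq\mathfrak{M}(W)$; (A3) for any $W\subseteq W'\subseteq S$, if $W\in\mathfrak{M}(W')$, then $\{M'\in\mathfrak{M}(W'):M'\subseteq W\}=\mathfrak{M}(W)$; (A4) for any $W\subseteq W'\subseteq S$, $M\in\mathfrak{M}(W)$ and $M'\in\mathfrak{M}(W')$, if $M\cap M'=\emptyset$ and $M'\cap W\neq\emptyset$, then $M\in\mathfrak{M}(W\cup M')$; (A5) for any $W\subseteq W'\subseteq S$, $M\in\mathfrak{M}(W)$ and $M'\in\mathfrak{M}(W')$, if $M\cap M'\neq\emptyset$, then $M\cup M'\in\mathfrak{M}(W\cup M')$. -}

module Defs where

open import Data.Fin.Subset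
open import Data.Nat.Base using (ℕ; _≤_)
open import Data.Product.Base using (∃; _×_; _,_)
open import Level using (0ℓ)
open import Relation.Binary.PropositionalEquality.Core using (_≡_)
open import Relation.Unary using (Pred; _≐_) renaming (_∈_ to _∈ᶠ_)

-- Finite sets are subsets of an ambient Fin n, so that a hypergraph and its
-- induced subhypergraphs, whose vertex sets differ, all live in one type.

Family : ℕ → Set₁
Family n = Pred (Subset n) 0ℓ

record Hypergraph (n : ℕ) : Set₁ where
  field
    V    : Subset n
    E    : Family n
    E⊆V  : ∀ {e} → e ∈ᶠ E → e ⊆ V
    E≥2  : ∀ {e} → e ∈ᶠ E → 2 ≤ ∣ e ∣

open Hypergraph public

infix 8 _[_]

_[_] : ∀ {n} → Hypergraph n → Subset n → Hypergraph n
H [ W ] = record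
  { V    = W
  ; E    = λ e → e ∈ᶠ E H × e ⊆ W
  ; E⊆V  = λ { (_ , e⊆W) → e⊆W }
  ; E≥2  = λ { (e∈E , _) → E≥2 H e∈E }
  }

record IsModule {n : ℕ} (H : Hypergraph n) (M : Subset n) : Set where
  field
    M⊆V      : M ⊆ V H
    crossing : ∀ {e} → e ∈ᶠ E H → Nonempty (e ∩ M) → Nonempty (e ─ M) →
               ∃ λ m → m ∈ M
                     × e ∩ M ≡ ⁅ m ⁆
                     × (∀ {k} → k ∈ M → ((e - m) ∪ ⁅ k ⁆) ∈ᶠ E H)

𝓜 : ∀ {n} → Hypergraph n → Family n
𝓜 H M = IsModule H M

record IsPartitiveFamily {n : ℕ} (S : Subset n) (F : Family n) : Set where
  field
    subsets : ∀ {M} → M ∈ᶠ F → M ⊆ S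
    ⊥∈      : ⊥ ∈ᶠ F
    S∈      : S ∈ᶠ F
    ⁅⁆∈     : ∀ {x} → x ∈ S → ⁅ x ⁆ ∈ᶠ F
    ∩∈      : ∀ {M N} → M ∈ᶠ F → N ∈ᶠ F → (M ∩ N) ∈ᶠ F
    ∪∈-△∈   : ∀ {M N} → M ∈ᶠ F → N ∈ᶠ F →
              Nonempty (M ∩ N) → Nonempty (M ─ N) → Nonempty (N ─ M) →
              (M ∪ N) ∈ᶠ F × ((M ─ N) ∪ (N ─ M)) ∈ᶠ F

-- A function on the subsets of S is represented by a function on all subsets
-- of Fin n; its values at subsets not contained in S are irrelevant.  That
-- 𝔐 W consists of subsets of W is part of A1, via IsPartitiveFamily.subsets.

record IsModularCovering {n : ℕ} (S : Subset n) (𝔐 : Subset n → Family n) : Set where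
  field
    A1 : ∀ {W} → W ⊆ S → IsPartitiveFamily W (𝔐 W)
    A2 : ∀ {W W′} → W ⊆ W′ → W′ ⊆ S →
         ∀ {M′} → M′ ∈ᶠ 𝔐 W′ → (M′ ∩ W) ∈ᶠ 𝔐 W
    A3 : ∀ {W W′} → W ⊆ W′ → W′ ⊆ S → W ∈ᶠ 𝔐 W′ →
         (λ M′ → M′ ∈ᶠ 𝔐 W′ × M′ ⊆ W) ≐ 𝔐 W
    A4 : ∀ {W W′} → W ⊆ W′ → W′ ⊆ S →
         ∀ {M M′} → M ∈ᶠ 𝔐 W → M′ ∈ᶠ 𝔐 W′ →
         Empty (M ∩ M′) → Nonempty (M′ ∩ W) → M ∈ᶠ 𝔐 (W ∪ M′)
    A5 : ∀ {W W′} → W ⊆ W′ → W′ ⊆ S →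
         ∀ {M M′} → M ∈ᶠ 𝔐 W → M′ ∈ᶠ 𝔐 W′ →
         Nonempty (M ∩ M′) → (M ∪ M′) ∈ᶠ 𝔐 (W ∪ M′)

{-# OPTIONS --safe #-}
-- For an edge e meeting M in x and leaving M, being a module means that x is the
-- only vertex of e in M and that every e [ x ↦ k ] with k ∈ M is again an edge.
-- The proof replaces vertices of e one after the other, each time by a
-- vertex of the same module: a detour through a vertex c of a second module
-- moves e to an edge on which the hypotheses apply, and the composite of the
-- replacements is the desired one because c is not a vertex of e (or is x itself).
module Submission where

open import Defs
open import Data.Nat.Base using (ℕ)
open import Data.Fin.Base using (Fin)
open import Data.Fin.Properties using (_≟_)
open import Data.Fin.Subset
open import Data.Fin.Subset.Properties
open import Data.Product.Base using (∃; _×_; _,_; proj₁; proj₂)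
open import Data.Sum.Base using (_⊎_; inj₁; inj₂; [_,_]′)
open import Data.Vec.Base using (_∷_; there)
open import Function.Base using (_∘_)
open import Relation.Binary.PropositionalEquality
  using (_≡_; _≢_; refl; sym; subst)
open import Relation.Nullary using (yes; no; contradiction)
open import Relation.Nullary.Decidable using (decidable-stable)
open import Relation.Unary using () renaming (_∈_ to _∈ᶠ_)

private
  variable
    n : ℕ
    c d k x y z : Fin n
    e M N W : Subset n

x∈p─q⇒x∉q : ∀ (p q : Subset n) → x ∈ p ─ q → x ∉ q
x∈p─q⇒x∉q (_ ∷ p) (inside  ∷ q) (there x∈) (there x∈q) = x∈p─q⇒x∉q p q x∈ x∈q
x∈p─q⇒x∉q (_ ∷ p) (outside ∷ q) (there x∈) (there x∈q) = x∈p─q⇒x∉q p q x∈ x∈q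

-- Replacing one vertex of a set by another, and composing replacements.

infixl 8 _[_↦_]
_[_↦_] : Subset n → Fin n → Fin n → Subset n
e [ x ↦ k ] = (e - x) ∪ ⁅ k ⁆

∈-[↦]-new : k ∈ e [ x ↦ k ]
∈-[↦]-new {k = k} = x∈p∪q⁺ (inj₂ (x∈⁅x⁆ k))

∈-[↦]-old : z ∈ e → z ≢ x → z ∈ e [ x ↦ k ]
∈-[↦]-old z∈e z≢x = x∈p∪q⁺ (inj₁ (x∈p∧x≢y⇒x∈p-y z∈e z≢x))

∈-[↦]⁻ : z ∈ e [ x ↦ k ] → (z ∈ e × z ≢ x) ⊎ z ≡ k
∈-[↦]⁻ {e = e} {x = x} {k = k} z∈ with x∈p∪q⁻ (e - x) ⁅ k ⁆ z∈
... | inj₁ z∈- = inj₁ (p─q⊆p e ⁅ x ⁆ z∈- , x∉⁅y⁆⇒x≢y (x∈p─q⇒x∉q e ⁅ x ⁆ z∈-))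
... | inj₂ z∈k = inj₂ (x∈⁅y⁆⇒x≡y k z∈k)

[↦]-⊆ : (∀ {z} → z ∈ e → z ≢ x → z ∈ W) → k ∈ W → e [ x ↦ k ] ⊆ W
[↦]-⊆ e⊆ k∈W z∈ with ∈-[↦]⁻ z∈
... | inj₁ (z∈e , z≢x) = e⊆ z∈e z≢x
... | inj₂ refl        = k∈W

[↦]-refl : x ∈ e → e [ x ↦ x ] ≡ e
[↦]-refl {x = x} {e = e} x∈e = ⊆-antisym ([↦]-⊆ (λ z∈e _ → z∈e) x∈e) RHS⊆LHS
  where
  RHS⊆LHS : e ⊆ e [ x ↦ x ]
  RHS⊆LHS {z} z∈e with z ≟ x
  ... | yes refl = ∈-[↦]-new
  ... | no z≢x   = ∈-[↦]-old z∈e z≢x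

-- A vertex `c` of `e` other than `x` would be lost in the second replacement; the hypothesis
-- excludes this.
[↦]-trans : (c ∈ e → c ≡ x) → e [ x ↦ c ] [ c ↦ k ] ≡ e [ x ↦ k ]
[↦]-trans {c = c} {e = e} {x = x} {k = k} c∈e⇒c≡x =
  ⊆-antisym ([↦]-⊆ LHS⊆RHS ∈-[↦]-new) ([↦]-⊆ RHS⊆LHS ∈-[↦]-new)
  where
  LHS⊆RHS : z ∈ e [ x ↦ c ] → z ≢ c → z ∈ e [ x ↦ k ]
  LHS⊆RHS z∈ z≢c with ∈-[↦]⁻ z∈
  ... | inj₁ (z∈e , z≢x) = ∈-[↦]-old z∈e z≢x
  ... | inj₂ z≡c         = contradiction z≡c z≢c
  RHS⊆LHS : z ∈ e → z ≢ x → z ∈ e [ x ↦ c ] [ c ↦ k ]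
  RHS⊆LHS z∈e z≢x = ∈-[↦]-old (∈-[↦]-old z∈e z≢x) λ { refl → z≢x (c∈e⇒c≡x z∈e) }

-- The vertex `d` is parked at `c` while `x` is replaced, then put back. As `c` is new to `e` and
-- differs from `k`, putting `d` back removes nothing else.
[↦]-detour : c ∉ e → d ∈ e → d ≢ x → k ≢ c →
             e [ d ↦ c ] [ x ↦ k ] [ c ↦ d ] ≡ e [ x ↦ k ]
[↦]-detour {c = c} {e = e} {d = d} {x = x} {k = k} c∉e d∈e d≢x k≢c =
  ⊆-antisym ([↦]-⊆ LHS⊆RHS (∈-[↦]-old d∈e d≢x)) ([↦]-⊆ RHS⊆LHS (∈-[↦]-old ∈-[↦]-new k≢c))
  where
  LHS⊆RHS : z ∈ e [ d ↦ c ] [ x ↦ k ] → z ≢ c → z ∈ e [ x ↦ k ]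
  LHS⊆RHS z∈ z≢c with ∈-[↦]⁻ z∈
  ... | inj₂ refl = ∈-[↦]-new
  ... | inj₁ (z∈′ , z≢x) with ∈-[↦]⁻ z∈′
  ...   | inj₁ (z∈e , _) = ∈-[↦]-old z∈e z≢x
  ...   | inj₂ z≡c       = contradiction z≡c z≢c
  RHS⊆LHS : z ∈ e → z ≢ x → z ∈ e [ d ↦ c ] [ x ↦ k ] [ c ↦ d ]
  RHS⊆LHS {z} z∈e z≢x with z ≟ d
  ... | yes refl = ∈-[↦]-new
  ... | no z≢d   = ∈-[↦]-old (∈-[↦]-old (∈-[↦]-old z∈e z≢d) z≢x) λ { refl → c∉e z∈e }

-- The place of `y` is vacated for `k` and then refilled from `x`, so as a set only `x` is traded
-- for `k`.
[↦]-rotate : y ∈ e → y ≢ x → k ≢ x → e [ y ↦ k ] [ x ↦ y ] ≡ e [ x ↦ k ]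
[↦]-rotate {y = y} {e = e} {x = x} {k = k} y∈e y≢x k≢x =
  ⊆-antisym ([↦]-⊆ LHS⊆RHS (∈-[↦]-old y∈e y≢x)) ([↦]-⊆ RHS⊆LHS (∈-[↦]-old ∈-[↦]-new k≢x))
  where
  LHS⊆RHS : z ∈ e [ y ↦ k ] → z ≢ x → z ∈ e [ x ↦ k ]
  LHS⊆RHS z∈ z≢x with ∈-[↦]⁻ z∈
  ... | inj₁ (z∈e , _) = ∈-[↦]-old z∈e z≢x
  ... | inj₂ refl      = ∈-[↦]-new
  RHS⊆LHS : z ∈ e → z ≢ x → z ∈ e [ y ↦ k ] [ x ↦ y ]
  RHS⊆LHS {z} z∈e z≢x with z ≟ y
  ... | yes refl = ∈-[↦]-new
  ... | no z≢y   = ∈-[↦]-old (∈-[↦]-old z∈e z≢y) z≢x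

-- Inclusion, union and symmetric difference of subsets.

p⊈q⇒∃ : e ⊈ W → ∃ λ x → x ∈ e × x ∉ W
p⊈q⇒∃ {e = e} {W = W} e⊈W with nonempty? (e ─ W)
... | yes (x , x∈) = x , p─q⊆p e W x∈ , x∈p─q⇒x∉q e W x∈
... | no  empty    = contradiction
  (λ {x} x∈e → decidable-stable (x ∈? W) λ x∉W → empty (x , x∈p∧x∉q⇒x∈p─q x∈e x∉W)) e⊈W

∪-⊆ : M ⊆ W → N ⊆ W → M ∪ N ⊆ W
∪-⊆ {M = M} {N = N} M⊆W N⊆W x∈ = [ M⊆W , N⊆W ]′ (x∈p∪q⁻ M N x∈)

infixr 6 _△_
_△_ : Subset n → Subset n → Subset n
M △ N = (M ─ N) ∪ (N ─ M)

x∈p△q⁻ : ∀ (M N : Subset n) → x ∈ M △ N → (x ∈ M × x ∉ N) ⊎ (x ∈ N × x ∉ M)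
x∈p△q⁻ M N x∈ with x∈p∪q⁻ (M ─ N) (N ─ M) x∈
... | inj₁ x∈M─N = inj₁ (p─q⊆p M N x∈M─N , x∈p─q⇒x∉q M N x∈M─N)
... | inj₂ x∈N─M = inj₂ (p─q⊆p N M x∈N─M , x∈p─q⇒x∉q N M x∈N─M)

-- Modules of induced subhypergraphs, expressed by vertex replacement.

module _ {n : ℕ} (H : Hypergraph n) where

  private
    variable
      a v w : Fin n
      f P Q U U′ : Subset n

  -- New edges are taken in `E H`, not in an induced subhypergraph, so that replacements obtained
  -- over different vertex sets can be chained.
  record Replaceable (M e : Subset n) (x : Fin n) : Set where
    constructor replaceable
    field
      unique  : ∀ {z} → z ∈ e → z ∈ M → z ≡ x
      replace : ∀ {k} → k ∈ M → e [ x ↦ k ] ∈ᶠ E H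

  open Replaceable

  -- The vertex supplied by the module condition must be `v`, because `v` lies in the singleton
  -- `f ∩ P`.
  cross : P ∈ᶠ 𝓜 (H [ U ]) → f ∈ᶠ E H → f ⊆ U →
          v ∈ f → v ∈ P → w ∈ f → w ∉ P → Replaceable P f v
  cross {P = P} {f = f} {v = v} P∈ f∈E f⊆U v∈f v∈P w∈f w∉P
    with IsModule.crossing P∈ (f∈E , f⊆U) (v , x∈p∩q⁺ (v∈f , v∈P))
                                          (_ , x∈p∧x∉q⇒x∈p─q w∈f w∉P)
  ... | m , _ , f∩P≡m , subst∈E = replaceable-at (only v∈f v∈P)
    where
    only : z ∈ f → z ∈ P → z ≡ m
    only {z} z∈f z∈P = x∈⁅y⁆⇒x≡y m (subst (z ∈_) f∩P≡m (x∈p∩q⁺ (z∈f , z∈P)))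
    replaceable-at : v ≡ m → Replaceable P f v
    replaceable-at refl = replaceable only (proj₁ ∘ subst∈E)

  -- Replacing a vertex of `e ⊆ U` by one of `P ⊆ U` stays inside `U`, so it is enough to find the
  -- new edge in `H`.
  module-intro : P ⊆ U →
    (∀ {e x y} → e ∈ᶠ E H → e ⊆ U → x ∈ e → x ∈ P → y ∈ e → y ∉ P → Replaceable P e x) →
    P ∈ᶠ 𝓜 (H [ U ])
  module-intro {P = P} {U = U} P⊆U crossing = record { M⊆V = P⊆U ; crossing = crossing′ }
    where
    crossing′ : f ∈ᶠ E (H [ U ]) → Nonempty (f ∩ P) → Nonempty (f ─ P) →
      ∃ λ m → m ∈ P × f ∩ P ≡ ⁅ m ⁆ × (∀ {k} → k ∈ P → f [ m ↦ k ] ∈ᶠ E (H [ U ]))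
    crossing′ {f = f} (f∈E , f⊆U) (v , v∈) (w , w∈) =
      v , v∈P , ⊆-antisym f∩P⊆⁅v⁆ (λ z∈ → subst (_∈ f ∩ P) (sym (x∈⁅y⁆⇒x≡y v z∈)) v∈) ,
      λ k∈P → replace r k∈P , [↦]-⊆ (λ z∈f _ → f⊆U z∈f) (P⊆U k∈P)
      where
      v∈f = proj₁ (x∈p∩q⁻ f P v∈)
      v∈P = proj₂ (x∈p∩q⁻ f P v∈)
      r : Replaceable P f v
      r = crossing f∈E f⊆U v∈f v∈P (p─q⊆p f P w∈) (x∈p─q⇒x∉q f P w∈)
      f∩P⊆⁅v⁆ : f ∩ P ⊆ ⁅ v ⁆
      f∩P⊆⁅v⁆ z∈ with x∈p∩q⁻ f P z∈
      ... | z∈f , z∈P = subst (_∈ ⁅ v ⁆) (sym (unique r z∈f z∈P)) (x∈⁅x⁆ v)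

  -- Restrictions, intersections and trivial modules.

  module-∩-⊆ : U ⊆ U′ → P ∈ᶠ 𝓜 (H [ U′ ]) → (P ∩ U) ∈ᶠ 𝓜 (H [ U ])
  module-∩-⊆ {U = U} {P = P} U⊆U′ P∈ = module-intro (p∩q⊆q P U)
    λ e∈E e⊆U x∈e x∈ y∈e y∉ →
      let r = cross P∈ e∈E (U⊆U′ ∘ e⊆U) x∈e (p∩q⊆p P U x∈) y∈e
                    (λ y∈P → y∉ (x∈p∩q⁺ (y∈P , e⊆U y∈e)))
      in replaceable (λ z∈e z∈ → unique r z∈e (p∩q⊆p P U z∈)) (replace r ∘ p∩q⊆p P U)

  module-⊆ : U ⊆ U′ → P ⊆ U → P ∈ᶠ 𝓜 (H [ U′ ]) → P ∈ᶠ 𝓜 (H [ U ])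
  module-⊆ {U = U} U⊆U′ P⊆U P∈ = module-intro P⊆U
    λ e∈E e⊆U → cross P∈ e∈E (U⊆U′ ∘ e⊆U)

  -- An edge leaving `P ∩ Q` leaves `P` or `Q`; the module it leaves yields uniqueness and
  -- replacement, and both restrict to `P ∩ Q`.
  module-∩ : P ∈ᶠ 𝓜 (H [ U ]) → Q ∈ᶠ 𝓜 (H [ U ]) → (P ∩ Q) ∈ᶠ 𝓜 (H [ U ])
  module-∩ {P = P} {U = U} {Q = Q} P∈ Q∈ =
    module-intro (IsModule.M⊆V P∈ ∘ p∩q⊆p P Q) crossing
    where
    crossing : f ∈ᶠ E H → f ⊆ U → v ∈ f → v ∈ P ∩ Q → w ∈ f → w ∉ P ∩ Q →
               Replaceable (P ∩ Q) f v
    crossing {w = w} f∈E f⊆U v∈f v∈ w∈f w∉ with w ∈? P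
    ... | no w∉P =
      let r = cross P∈ f∈E f⊆U v∈f (p∩q⊆p P Q v∈) w∈f w∉P
      in replaceable (λ z∈f z∈ → unique r z∈f (p∩q⊆p P Q z∈)) (replace r ∘ p∩q⊆p P Q)
    ... | yes w∈P =
      let r = cross Q∈ f∈E f⊆U v∈f (p∩q⊆q P Q v∈) w∈f (λ w∈Q → w∉ (x∈p∩q⁺ (w∈P , w∈Q)))
      in replaceable (λ z∈f z∈ → unique r z∈f (p∩q⊆q P Q z∈)) (replace r ∘ p∩q⊆q P Q)

  module-⊥ : ⊥ ∈ᶠ 𝓜 (H [ U ])
  module-⊥ = module-intro ⊥⊆ λ _ _ _ x∈⊥ → contradiction x∈⊥ ∉⊥

  module-full : U ∈ᶠ 𝓜 (H [ U ])
  module-full = module-intro ⊆-refl λ _ e⊆U _ _ y∈e y∉U → contradiction (e⊆U y∈e) y∉U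

  module-⁅⁆ : v ∈ U → ⁅ v ⁆ ∈ᶠ 𝓜 (H [ U ])
  module-⁅⁆ {v = v} {U = U} v∈U = module-intro ⁅v⁆⊆U crossing
    where
    ⁅v⁆⊆U : ⁅ v ⁆ ⊆ U
    ⁅v⁆⊆U z∈ with refl ← x∈⁅y⁆⇒x≡y v z∈ = v∈U
    crossing : f ∈ᶠ E H → f ⊆ U → w ∈ f → w ∈ ⁅ v ⁆ → a ∈ f → a ∉ ⁅ v ⁆ →
               Replaceable ⁅ v ⁆ f w
    crossing {f = f} f∈E _ w∈f w∈v _ _ with refl ← x∈⁅y⁆⇒x≡y v w∈v = replaceable
      (λ _ z∈v → x∈⁅y⁆⇒x≡y v z∈v)
      λ k∈v → subst (λ k → f [ v ↦ k ] ∈ᶠ E H) (sym (x∈⁅y⁆⇒x≡y v k∈v))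
                    (subst (_∈ᶠ E H) (sym ([↦]-refl w∈f)) f∈E)

  -- Passing from modules of a subhypergraph to those of a larger one.

  module-lift : U ∈ᶠ 𝓜 (H [ U′ ]) → P ∈ᶠ 𝓜 (H [ U ]) → P ∈ᶠ 𝓜 (H [ U′ ])
  module-lift {U = U} {U′ = U′} {P = P} U∈ P∈ = module-intro (IsModule.M⊆V U∈ ∘ P⊆U) crossing
    where
    P⊆U : P ⊆ U
    P⊆U = IsModule.M⊆V P∈
    crossing : f ∈ᶠ E H → f ⊆ U′ → v ∈ f → v ∈ P → w ∈ f → w ∉ P → Replaceable P f v
    crossing {f = f} f∈E f⊆U′ v∈f v∈P w∈f w∉P with f ⊆? U
    ... | yes f⊆U = cross P∈ f∈E f⊆U v∈f v∈P w∈f w∉P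
    -- The edge leaves `U`, itself a module of the larger subhypergraph, and what `U` gives
    -- restricts to `P`.
    ... | no  f⊈U =
      let _ , a∈f , a∉U = p⊈q⇒∃ f⊈U
          r = cross U∈ f∈E f⊆U′ v∈f (P⊆U v∈P) a∈f a∉U
      in replaceable (λ z∈f z∈P → unique r z∈f (P⊆U z∈P)) (replace r ∘ P⊆U)

  -- An edge not inside `U` has a vertex `d` in `Q`, the only one there since the edge also meets
  -- `P`. Moving `d` to a vertex `c` of `Q ∩ U` brings the edge into `U`, where `P` is a module;
  -- afterwards `c` is moved back to `d`.
  module-disjoint : U ⊆ U′ → P ∈ᶠ 𝓜 (H [ U ]) → Q ∈ᶠ 𝓜 (H [ U′ ]) →
                    Empty (P ∩ Q) → Nonempty (Q ∩ U) → P ∈ᶠ 𝓜 (H [ U ∪ Q ])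
  module-disjoint {U = U} {U′ = U′} {P = P} {Q = Q} U⊆U′ P∈ Q∈ P∩Q≡∅ (c , c∈) =
    module-intro (p⊆p∪q Q ∘ IsModule.M⊆V P∈) crossing
    where
    c∈Q = proj₁ (x∈p∩q⁻ Q U c∈)
    c∈U = proj₂ (x∈p∩q⁻ Q U c∈)
    P∌Q : a ∈ P → a ∉ Q
    P∌Q a∈P a∈Q = P∩Q≡∅ (_ , x∈p∩q⁺ (a∈P , a∈Q))
    crossing : f ∈ᶠ E H → f ⊆ U ∪ Q → v ∈ f → v ∈ P → w ∈ f → w ∉ P → Replaceable P f v
    crossing {f = f} {v = v} f∈E f⊆ v∈f v∈P w∈f w∉P with f ⊆? U
    ... | yes f⊆U = cross P∈ f∈E f⊆U v∈f v∈P w∈f w∉P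
    ... | no  f⊈U with p⊈q⇒∃ f⊈U
    ... | d , d∈f , d∉U = replaceable
      (λ z∈f z∈P → unique s (∈-[↦]-old z∈f (λ { refl → P∌Q z∈P d∈Q })) z∈P)
      back
      where
      d∈Q : d ∈ Q
      d∈Q = [ (λ d∈U → contradiction d∈U d∉U) , (λ d∈Q → d∈Q) ]′ (x∈p∪q⁻ U Q (f⊆ d∈f))
      f⊆U′ : f ⊆ U′
      f⊆U′ = ∪-⊆ U⊆U′ (IsModule.M⊆V Q∈) ∘ f⊆
      r : Replaceable Q f d
      r = cross Q∈ f∈E f⊆U′ d∈f d∈Q v∈f (P∌Q v∈P)
      c∉f : c ∉ f
      c∉f c∈f = d∉U (subst (_∈ U) (unique r c∈f c∈Q) c∈U)
      v≢d : v ≢ d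
      v≢d refl = P∌Q v∈P d∈Q
      old : ∀ {z} → z ∈ f → z ≢ d → z ∈ U
      old z∈f z≢d with x∈p∪q⁻ U Q (f⊆ z∈f)
      ... | inj₁ z∈U = z∈U
      ... | inj₂ z∈Q = contradiction (unique r z∈f z∈Q) z≢d
      s : Replaceable P (f [ d ↦ c ]) v
      s = cross P∈ (replace r c∈Q) ([↦]-⊆ old c∈U) (∈-[↦]-old v∈f v≢d) v∈P
                ∈-[↦]-new (λ c∈P → P∌Q c∈P c∈Q)
      back : ∀ {k} → k ∈ P → f [ v ↦ k ] ∈ᶠ E H
      -- Once `v` has become `k`, the edge meets `Q` in `c` and leaves `Q` at `k`, so `Q` lets `c`
      -- go back to `d`.
      back k∈P = subst (_∈ᶠ E H) ([↦]-detour c∉f d∈f (v≢d ∘ sym) (λ { refl → P∌Q k∈P c∈Q }))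
        (replace (cross Q∈ (replace s k∈P)
                    ([↦]-⊆ (λ z∈ _ → [↦]-⊆ (λ z∈f _ → f⊆U′ z∈f) (U⊆U′ c∈U) z∈)
                           (U⊆U′ (IsModule.M⊆V P∈ k∈P)))
                    (∈-[↦]-old ∈-[↦]-new (λ { refl → P∌Q v∈P c∈Q })) c∈Q
                    ∈-[↦]-new (P∌Q k∈P))
                 d∈Q)

  -- A common vertex `c` links the two modules: a replacement passing from one to the other is made
  -- in two stages through `c`.
  module-overlap : U ⊆ U′ → P ∈ᶠ 𝓜 (H [ U ]) → Q ∈ᶠ 𝓜 (H [ U′ ]) →
                   Nonempty (P ∩ Q) → (P ∪ Q) ∈ᶠ 𝓜 (H [ U ∪ Q ])
  module-overlap {U = U} {U′ = U′} {P = P} {Q = Q} U⊆U′ P∈ Q∈ (c , c∈) =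
    module-intro (∪-⊆ (p⊆p∪q Q ∘ P⊆U) (q⊆p∪q U Q)) crossing
    where
    P⊆U = IsModule.M⊆V P∈
    Q⊆U′ = IsModule.M⊆V Q∈
    c∈P = proj₁ (x∈p∩q⁻ P Q c∈)
    c∈Q = proj₂ (x∈p∩q⁻ P Q c∈)
    crossing : f ∈ᶠ E H → f ⊆ U ∪ Q → v ∈ f → v ∈ P ∪ Q → w ∈ f → w ∉ P ∪ Q →
               Replaceable (P ∪ Q) f v
    crossing {f = f} {v = v} {w = w} f∈E f⊆ v∈f v∈ w∈f w∉ with nonempty? (f ∩ Q)
    ... | no f∩Q≡∅ = replaceable only rep
      where
      f∌Q : a ∈ f → a ∉ Q
      f∌Q a∈f a∈Q = f∩Q≡∅ (_ , x∈p∩q⁺ (a∈f , a∈Q))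
      ∈P : a ∈ f → a ∈ P ∪ Q → a ∈ P
      ∈P a∈f a∈ = [ (λ a∈P → a∈P) , (λ a∈Q → contradiction a∈Q (f∌Q a∈f)) ]′ (x∈p∪q⁻ P Q a∈)
      f⊆U : f ⊆ U
      f⊆U a∈f = [ (λ a∈U → a∈U) , (λ a∈Q → contradiction a∈Q (f∌Q a∈f)) ]′ (x∈p∪q⁻ U Q (f⊆ a∈f))
      r : Replaceable P f v
      r = cross P∈ f∈E f⊆U v∈f (∈P v∈f v∈) w∈f (w∉ ∘ p⊆p∪q Q)
      only : ∀ {z} → z ∈ f → z ∈ P ∪ Q → z ≡ v
      only z∈f z∈ = unique r z∈f (∈P z∈f z∈)
      rep : ∀ {k} → k ∈ P ∪ Q → f [ v ↦ k ] ∈ᶠ E H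
      rep k∈ with x∈p∪q⁻ P Q k∈
      ... | inj₁ k∈P = replace r k∈P
      ... | inj₂ k∈Q = subst (_∈ᶠ E H) ([↦]-trans (λ c∈f → contradiction c∈Q (f∌Q c∈f)))
        (replace (cross Q∈ (replace r c∈P)
                    ([↦]-⊆ (λ z∈f _ → U⊆U′ (f⊆U z∈f)) (Q⊆U′ c∈Q)) ∈-[↦]-new c∈Q
                    (∈-[↦]-old w∈f (λ { refl → w∉ v∈ })) (w∉ ∘ q⊆p∪q P Q))
                 k∈Q)
    -- The vertex `x` of the edge in `Q` serves as crossing vertex; `only` identifies `v` with it.
    ... | yes (x , x∈) = subst (Replaceable (P ∪ Q) f) (sym (only v∈f v∈)) (replaceable only rep)
      where
      x∈f = proj₁ (x∈p∩q⁻ f Q x∈)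
      x∈Q = proj₂ (x∈p∩q⁻ f Q x∈)
      r : Replaceable Q f x
      r = cross Q∈ f∈E (∪-⊆ U⊆U′ Q⊆U′ ∘ f⊆) x∈f x∈Q w∈f (w∉ ∘ q⊆p∪q P Q)
      old : ∀ {z} → z ∈ f → z ≢ x → z ∈ U
      old z∈f z≢x with x∈p∪q⁻ U Q (f⊆ z∈f)
      ... | inj₁ z∈U = z∈U
      ... | inj₂ z∈Q = contradiction (unique r z∈f z∈Q) z≢x
      -- As `x` is the only vertex of the edge in `Q`, moving it to `c` brings the edge into `U`,
      -- crossing `P` at `c`.
      s : Replaceable P (f [ x ↦ c ]) c
      s = cross P∈ (replace r c∈Q) ([↦]-⊆ old (P⊆U c∈P)) ∈-[↦]-new c∈P
                (∈-[↦]-old w∈f (λ { refl → w∉ (q⊆p∪q P Q x∈Q) })) (w∉ ∘ p⊆p∪q Q)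
      only : ∀ {z} → z ∈ f → z ∈ P ∪ Q → z ≡ x
      only {z} z∈f z∈ with x∈p∪q⁻ P Q z∈
      ... | inj₂ z∈Q = unique r z∈f z∈Q
      -- If `z` is not `x`, it survives the move to `c`; then `P` forces `z` to be `c`, hence in
      -- `Q`, and `Q` forces `z` to be `x`.
      ... | inj₁ z∈P = decidable-stable (z ≟ x) λ z≢x →
        z≢x (unique r z∈f (subst (_∈ Q) (sym (unique s (∈-[↦]-old z∈f z≢x) z∈P)) c∈Q))
      rep : ∀ {k} → k ∈ P ∪ Q → f [ x ↦ k ] ∈ᶠ E H
      rep k∈ with x∈p∪q⁻ P Q k∈
      ... | inj₁ k∈P = subst (_∈ᶠ E H) ([↦]-trans (λ c∈f → unique r c∈f c∈Q)) (replace s k∈P)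
      ... | inj₂ k∈Q = replace r k∈Q

  -- Union and symmetric difference of overlapping modules.

  module-∪ : P ∈ᶠ 𝓜 (H [ U ]) → Q ∈ᶠ 𝓜 (H [ U ]) → Nonempty (P ∩ Q) → (P ∪ Q) ∈ᶠ 𝓜 (H [ U ])
  module-∪ {Q = Q} P∈ Q∈ P∩Q≢∅ =
    module-⊆ (p⊆p∪q Q) (∪-⊆ (IsModule.M⊆V P∈) (IsModule.M⊆V Q∈)) (module-overlap ⊆-refl P∈ Q∈ P∩Q≢∅)

  -- A vertex outside `P △ Q` lies outside `P ∪ Q`, where the module `P ∪ Q` settles the matter, or
  -- in `P ∩ Q`. In the latter case a vertex of `Q ─ P` serves to make the edge leave `P`.
  △-replaceable : P ∈ᶠ 𝓜 (H [ U ]) → Q ∈ᶠ 𝓜 (H [ U ]) → Nonempty (P ∩ Q) → Nonempty (Q ─ P) →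
                  f ∈ᶠ E H → f ⊆ U → v ∈ f → v ∈ P → v ∉ Q → w ∈ f → w ∉ P △ Q →
                  Replaceable (P △ Q) f v
  △-replaceable {P = P} {U = U} {Q = Q} {f = f} {v = v} {w = w}
                P∈ Q∈ P∩Q≢∅ (b , b∈) f∈E f⊆U v∈f v∈P v∉Q w∈f w∉△ with w ∈? P
  ... | no w∉P = replaceable (λ z∈f z∈ → unique r z∈f (△⊆∪ z∈)) (replace r ∘ △⊆∪)
    where
    △⊆∪ : P △ Q ⊆ P ∪ Q
    △⊆∪ = ∪-⊆ (p⊆p∪q Q ∘ p─q⊆p P Q) (q⊆p∪q P Q ∘ p─q⊆p Q P)
    w∉∪ : w ∉ P ∪ Q
    w∉∪ w∈ with x∈p∪q⁻ P Q w∈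
    ... | inj₁ w∈P = w∉P w∈P
    ... | inj₂ w∈Q = w∉△ (q⊆p∪q (P ─ Q) (Q ─ P) (x∈p∧x∉q⇒x∈p─q w∈Q w∉P))
    r : Replaceable (P ∪ Q) f v
    r = cross (module-∪ P∈ Q∈ P∩Q≢∅) f∈E f⊆U v∈f (p⊆p∪q Q v∈P) w∈f w∉∪
  -- Here f = {v, w} with v ∈ P ─ Q and w ∈ P ∩ Q.
  ... | yes w∈P = replaceable only rep
    where
    b∈Q = p─q⊆p Q P b∈
    b∉P = x∈p─q⇒x∉q Q P b∈
    w∈Q : w ∈ Q
    w∈Q = decidable-stable (w ∈? Q) λ w∉Q →
      w∉△ (p⊆p∪q (Q ─ P) (x∈p∧x∉q⇒x∈p─q w∈P w∉Q))
    w≢v : w ≢ v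
    w≢v refl = v∉Q w∈Q
    -- With two vertices `v` and `w` in `P`, the edge cannot cross `P`.
    f⊆P : f ⊆ P
    f⊆P {z} z∈f = decidable-stable (z ∈? P) λ z∉P →
      w≢v (unique (cross P∈ f∈E f⊆U v∈f v∈P z∈f z∉P) w∈f w∈P)
    r : Replaceable Q f w
    r = cross Q∈ f∈E f⊆U w∈f w∈Q v∈f v∉Q
    s : ∀ {k} → k ∈ Q → k ∉ P → Replaceable P (f [ w ↦ k ]) v
    s k∈Q k∉P = cross P∈ (replace r k∈Q) ([↦]-⊆ (λ z∈f _ → f⊆U z∈f) (IsModule.M⊆V Q∈ k∈Q))
                      (∈-[↦]-old v∈f (w≢v ∘ sym)) v∈P ∈-[↦]-new k∉P
    only : ∀ {z} → z ∈ f → z ∈ P △ Q → z ≡ v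
    only z∈f z∈ = unique (s b∈Q b∉P) (∈-[↦]-old z∈f (λ { refl → w∉△ z∈ })) (f⊆P z∈f)
    rep : ∀ {k} → k ∈ P △ Q → f [ v ↦ k ] ∈ᶠ E H
    rep k∈ with x∈p△q⁻ P Q k∈
    ... | inj₂ (k∈Q , k∉P) =
      subst (_∈ᶠ E H) ([↦]-rotate w∈f w≢v (λ { refl → k∉P v∈P })) (replace (s k∈Q k∉P) w∈P)
    -- Here `w` is parked at `b` while `v` becomes `k`; the edge then leaves `Q` at `k`, so `b` can
    -- return to `w`.
    ... | inj₁ (k∈P , k∉Q) =
      subst (_∈ᶠ E H) ([↦]-detour (b∉P ∘ f⊆P) w∈f w≢v (λ { refl → k∉Q b∈Q }))
        (replace (cross Q∈ (replace (s b∈Q b∉P) k∈P)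
                    ([↦]-⊆ (λ z∈ _ → [↦]-⊆ (λ z∈f _ → f⊆U z∈f) (IsModule.M⊆V Q∈ b∈Q) z∈)
                           (IsModule.M⊆V P∈ k∈P))
                    (∈-[↦]-old ∈-[↦]-new (λ { refl → b∉P v∈P })) b∈Q ∈-[↦]-new k∉Q)
                 w∈Q)

  module-△ : P ∈ᶠ 𝓜 (H [ U ]) → Q ∈ᶠ 𝓜 (H [ U ]) →
             Nonempty (P ∩ Q) → Nonempty (P ─ Q) → Nonempty (Q ─ P) → (P △ Q) ∈ᶠ 𝓜 (H [ U ])
  module-△ {P = P} {U = U} {Q = Q} P∈ Q∈ P∩Q≢∅ P─Q≢∅ Q─P≢∅ =
    module-intro (∪-⊆ (IsModule.M⊆V P∈ ∘ p─q⊆p P Q) (IsModule.M⊆V Q∈ ∘ p─q⊆p Q P)) crossing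
    where
    △-comm : P △ Q ≡ Q △ P
    △-comm = ∪-comm (P ─ Q) (Q ─ P)
    crossing : f ∈ᶠ E H → f ⊆ U → v ∈ f → v ∈ P △ Q → w ∈ f → w ∉ P △ Q →
               Replaceable (P △ Q) f v
    crossing {f = f} {v = v} {w = w} f∈E f⊆U v∈f v∈ w∈f w∉ with x∈p△q⁻ P Q v∈
    ... | inj₁ (v∈P , v∉Q) =
      △-replaceable P∈ Q∈ P∩Q≢∅ Q─P≢∅ f∈E f⊆U v∈f v∈P v∉Q w∈f w∉
    ... | inj₂ (v∈Q , v∉P) = subst (λ D → Replaceable D f v) (sym △-comm)
      (△-replaceable Q∈ P∈ (subst Nonempty (∩-comm P Q) P∩Q≢∅) P─Q≢∅ f∈E f⊆U v∈f v∈Q v∉P w∈f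
                     (subst (w ∉_) △-comm w∉))

proposition4 : (n : ℕ) (H : Hypergraph n) →
    IsModularCovering (V H) (λ W → 𝓜 (H [ W ]))
proposition4 n H = record
  { A1 = λ _ → record
    { subsets = IsModule.M⊆V
    ; ⊥∈      = module-⊥ H
    ; S∈      = module-full H
    ; ⁅⁆∈     = module-⁅⁆ H
    ; ∩∈      = module-∩ H
    ; ∪∈-△∈   = λ M∈ N∈ M∩N≢∅ M─N≢∅ N─M≢∅ →
        module-∪ H M∈ N∈ M∩N≢∅ , module-△ H M∈ N∈ M∩N≢∅ M─N≢∅ N─M≢∅
    }
  ; A2 = λ W⊆W′ _ → module-∩-⊆ H W⊆W′
  ; A3 = λ W⊆W′ _ W∈ →
      (λ (M∈ , M⊆W) → module-⊆ H W⊆W′ M⊆W M∈) ,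
      (λ M∈ → module-lift H W∈ M∈ , IsModule.M⊆V M∈)
  ; A4 = λ W⊆W′ _ → module-disjoint H W⊆W′
  ; A5 = λ W⊆W′ _ → module-overlap H W⊆W′
  }
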